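{- Let $K$ be a simplicial complex over a type $E$, let $s \in K$ be a face, let $x \in E$ with $x \notin V(K)$, and let $\sigma_s K$ be the stellar subdivision of $K$ at $s$ with barycenter $x$. If $t \in K \setminus \mathrm{St}(K,s)$ and $t \notin \mathrm{Lk}(K,s) \star \partial s$, then \[ \mathrm{Lk}(\sigma_s K, t) = \mathrm{Lk}(K,t). \]
   Context: A simplicial complex over a type (set) $E$ is a set $K$ of nonempty finite subsets of $E$ (its faces) such that every nonempty subset of a face is a face. It may be empty or infinite, and not every element of $E$ need be a vertex. $V(K) = \{x \in E \mid \{x\} \in K\}$. For a finite set $s \subseteq E$: the link is $\mathrm{Lk}(K,s) = \{t \in K \mid s \cup t \in K,\ s \cap t = \emptyset\}$; the boundary is $\partial s = \{t \subseteq s \mid t \ne \emptyset,\ t \neq s\}$; the star complement, written $K \setminus \mathrm{St}(K,s)$, is $\{t \in K \mid s \not\subseteq t\}$. For complexes $A, B$ over $E$ with disjoint vertex sets, $A \star B$ (regarded as a complex over $E$) has as faces all nonempty sets $a \cup b$ with $a \in A \cup \{\emptyset\}$, $b \in B \cup \{\emptyset\}$. For $s \in K$ and $x \in E \setminus V(K)$, the stellar subdivision of $K$ at $s$ with barycenter $x$ is $\sigma_s K = (K \setminus \mathrm{St}(K,s)) \cup (\mathrm{Lk}(K,s) \star \partial s \star \{x\})$, where $\{x\}$ denotes the complex with single face $\{x\}$. That is, the faces of $\sigma_s K$ are the faces of $K$ not containing $s$ together with all nonempty sets $a \cup b \cup c$ with $a \in \mathrm{Lk}(K,s) \cup \{\emptyset\}$,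 $b \in \partial s \cup \{\emptyset\}$, $c \in \{\emptyset, \{x\}\}$. -}

module Defs where

open import Level using (Level; _⊔_) renaming (suc to lsuc)
open import Data.List.Base using (List; []; _∷_; [_]; _++_)
open import Data.List.Relation.Unary.Any using (here; there)
open import Data.List.Relation.Binary.BagAndSetEquality using (_∼[_]_; set)
open import Data.List.Relation.Binary.Disjoint.Propositional using (Disjoint)
open import Data.List.Relation.Binary.Subset.Propositional using (_⊆_)
open import Data.List.Relation.Binary.Subset.Propositional.Properties
  using (⊆-trans; ++⁺ʳ; xs⊆ys++xs)
open import Data.List.Membership.Propositional using () renaming (_∈_ to _∈ˡ_)
open import Data.List.Membership.Propositional.Properties using (∈-++⁻; ∈-++⁺ˡ; ∈-++⁺ʳ)
open import Data.Product.Base using (∃₂; _×_; _,_)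
open import Data.Sum.Base using (_⊎_; inj₁; inj₂)
open import Function.Base using (_∘_)
open import Function.Bundles using (mk⇔; Equivalence)
open import Relation.Binary.PropositionalEquality using (_≡_; _≢_; refl)
open import Relation.Nullary using (¬_; contradiction)
open import Relation.Unary using (Pred; _≐_)

private
  variable
    e p q : Level
    E : Set e

-- A finite subset of E is given by a list of its elements; order and
-- repetitions are irrelevant, so two lists denote the same finite subset when
-- they have the same members.  Thus _⊆_ is inclusion and _++_ is union.

infix 4 _≈_
_≈_ : {E : Set e} → List E → List E → Set e
s ≈ t = s ∼[ set ] t

-- Whether a list is a face depends only on the subset it denotes: this is the
-- case of `down-closed` in which u ≈ t (see `face-resp-≈`).
record Complex (E : Set e) (p : Level) : Set (e ⊔ lsuc p) where
  field
    Face        : Pred (List E) p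
    nonempty    : ∀ {t} → Face t → t ≢ []
    down-closed : ∀ {t u} → Face t → u ⊆ t → u ≢ [] → Face u

open Complex

infix 4 _∈_ _∉_ _≗_

_∈_ : List E → Complex E p → Set p
t ∈ K = Face K t

_∉_ : List E → Complex E p → Set p
t ∉ K = ¬ (t ∈ K)

-- Equality of complexes is equality of their sets of faces.
_≗_ : {E : Set e} → Complex E p → Complex E q → Set (e ⊔ p ⊔ q)
K ≗ L = Face K ≐ Face L

V : Complex E p → Pred E p
V K x = [ x ] ∈ K

-- t ∈ K ∪ {∅}
infix 4 _∈₀_
_∈₀_ : {E : Set e} → List E → Complex E p → Set (e ⊔ p)
t ∈₀ K = t ∈ K ⊎ t ≡ []

≈⇒⊆ : {s t : List E} → s ≈ t → s ⊆ t
≈⇒⊆ s≈t = Equivalence.to s≈t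

≈⇒⊇ : {s t : List E} → s ≈ t → t ⊆ s
≈⇒⊇ s≈t = Equivalence.from s≈t

⊆-nonempty : {s t : List E} → s ⊆ t → s ≢ [] → t ≢ []
⊆-nonempty {s = []}    _   s≢[] refl = s≢[] refl
⊆-nonempty {s = y ∷ s} s⊆t _    refl with s⊆t (here refl)
... | ()

-- A subset of a ∪ b is the union of a subset of a and a subset of b.
split : {E : Set e} (a b u : List E) → u ⊆ a ++ b →
        ∃₂ λ a′ b′ → a′ ⊆ a × b′ ⊆ b × u ≈ a′ ++ b′
split a b [] _ = [] , [] , (λ ()) , (λ ()) , mk⇔ (λ ()) (λ ())
split a b (y ∷ u) u⊆ with split a b u (u⊆ ∘ there)
                        | ∈-++⁻ a (u⊆ (here refl))
... | a′ , b′ , a′⊆ , b′⊆ , eq | inj₁ y∈a =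
  y ∷ a′ , b′
  , (λ { (here refl) → y∈a ; (there z) → a′⊆ z })
  , b′⊆
  , mk⇔ (λ { (here refl) → here refl
           ; (there z) → there (≈⇒⊆ eq z) })
        (λ { (here refl) → here refl
           ; (there z) → there (≈⇒⊇ eq z) })
... | a′ , b′ , a′⊆ , b′⊆ , eq | inj₂ y∈b =
  a′ , y ∷ b′
  , a′⊆
  , (λ { (here refl) → y∈b ; (there z) → b′⊆ z })
  , mk⇔ to from
  where
  to : y ∷ u ⊆ a′ ++ y ∷ b′
  to (here refl) = ∈-++⁺ʳ a′ (here refl)
  to (there z) with ∈-++⁻ a′ (≈⇒⊆ eq z)
  ... | inj₁ i = ∈-++⁺ˡ i
  ... | inj₂ i = ∈-++⁺ʳ a′ (there i)

  from : a′ ++ y ∷ b′ ⊆ y ∷ u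
  from z with ∈-++⁻ a′ z
  ... | inj₁ i           = there (≈⇒⊇ eq (∈-++⁺ˡ i))
  ... | inj₂ (here refl) = here refl
  ... | inj₂ (there i)   = there (≈⇒⊇ eq (∈-++⁺ʳ a′ i))

∈₀-down : {E : Set e} (K : Complex E p) {t u : List E} → t ∈₀ K → u ⊆ t → u ∈₀ K
∈₀-down K {u = []}    _           _   = inj₂ refl
∈₀-down K {u = y ∷ u} (inj₁ t∈K)  u⊆t = inj₁ (down-closed K t∈K u⊆t (λ ()))
∈₀-down K {u = y ∷ u} (inj₂ refl) u⊆t with u⊆t (here refl)
... | ()

face-resp-≈ : {E : Set e} (K : Complex E p) {t u : List E} → t ≈ u → t ∈ K → u ∈ K
face-resp-≈ K t≈u t∈K =
  down-closed K t∈K (≈⇒⊇ t≈u) (⊆-nonempty (≈⇒⊆ t≈u) (nonempty K t∈K))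

Lk : {E : Set e} → Complex E p → List E → Complex E (e ⊔ p)
Lk K s .Face t = t ∈ K × (s ++ t) ∈ K × Disjoint s t
Lk K s .nonempty (t∈K , _) = nonempty K t∈K
Lk K s .down-closed (t∈K , st∈K , s#t) u⊆t u≢[] =
    down-closed K t∈K u⊆t u≢[]
  , down-closed K st∈K (++⁺ʳ s u⊆t) (⊆-nonempty (xs⊆ys++xs _ s) u≢[])
  , λ (v∈s , v∈u) → s#t (v∈s , u⊆t v∈u)

∂ : {E : Set e} → List E → Complex E e
∂ s .Face t = t ⊆ s × t ≢ [] × ¬ (t ≈ s)
∂ s .nonempty (_ , t≢[] , _) = t≢[]
∂ s .down-closed (t⊆s , _ , t≉s) u⊆t u≢[] =
  ⊆-trans u⊆t t⊆s , u≢[] , λ u≈s → t≉s (mk⇔ t⊆s (u⊆t ∘ ≈⇒⊇ u≈s))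

infix 8 _∖St_
_∖St_ : {E : Set e} → Complex E p → List E → Complex E (e ⊔ p)
(K ∖St s) .Face t = t ∈ K × ¬ (s ⊆ t)
(K ∖St s) .nonempty (t∈K , _) = nonempty K t∈K
(K ∖St s) .down-closed (t∈K , s⊈t) u⊆t u≢[] =
  down-closed K t∈K u⊆t u≢[] , λ s⊆u → s⊈t (⊆-trans s⊆u u⊆t)

-- Defined for all A and B, although it deserves the name of join only when the
-- vertex sets of A and B are disjoint; no proof of disjointness is demanded.
infixl 7 _⋆_
_⋆_ : {E : Set e} → Complex E p → Complex E q → Complex E (e ⊔ p ⊔ q)
(A ⋆ B) .Face u = u ≢ [] × ∃₂ λ a b → a ∈₀ A × b ∈₀ B × u ≈ a ++ b
(A ⋆ B) .nonempty (u≢[] , _) = u≢[]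
(A ⋆ B) .down-closed (_ , a , b , a∈A , b∈B , t≈ab) u⊆t u≢[]
  with a′ , b′ , a′⊆a , b′⊆b , u≈a′b′ ← split a b _ (≈⇒⊆ t≈ab ∘ u⊆t) =
  u≢[] , a′ , b′ , ∈₀-down A a∈A a′⊆a , ∈₀-down B b∈B b′⊆b , u≈a′b′

point : {E : Set e} → E → Complex E e
point x .Face t = t ≈ [ x ]
point x .nonempty t≈x refl with ≈⇒⊇ t≈x (here refl)
... | ()
point x .down-closed {u = []}    _   _   u≢[] = contradiction refl u≢[]
point x .down-closed {u = y ∷ u} t≈x u⊆t _    =
  mk⇔ (≈⇒⊆ t≈x ∘ u⊆t) λ { (here refl) → x∈ (≈⇒⊆ t≈x (u⊆t (here refl))) }
  where
  x∈ : y ∈ˡ [ x ] → x ∈ˡ y ∷ u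
  x∈ (here refl) = here refl

infixr 6 _∪_
_∪_ : {E : Set e} → Complex E p → Complex E q → Complex E (p ⊔ q)
(A ∪ B) .Face t = t ∈ A ⊎ t ∈ B
(A ∪ B) .nonempty (inj₁ t∈A) = nonempty A t∈A
(A ∪ B) .nonempty (inj₂ t∈B) = nonempty B t∈B
(A ∪ B) .down-closed (inj₁ t∈A) u⊆t u≢[] = inj₁ (down-closed A t∈A u⊆t u≢[])
(A ∪ B) .down-closed (inj₂ t∈B) u⊆t u≢[] = inj₂ (down-closed B t∈B u⊆t u≢[])

-- The stellar subdivision of K at s with barycenter x.  It is meaningful when
-- s ∈ K and x is not a vertex of K, in which case the vertex sets of the
-- joined complexes are disjoint.
σ : {E : Set e} → Complex E p → List E → E → Complex E (e ⊔ p)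
σ K s x = K ∖St s ∪ Lk K s ⋆ ∂ s ⋆ point x

{-# OPTIONS --safe #-}

-- A face of σ K s x that contains t but is not in K ∖St s lies in the join
-- Lk K s ⋆ ∂ s ⋆ point x; as x is not in t, this puts t in Lk K s ⋆ ∂ s.
-- Conversely, if t ∪ u ∈ K contained s, then t = (t ∖ s) ∪ (t ∩ s) would
-- exhibit t as a face of Lk K s ⋆ ∂ s.

module Submission where

open import Defs
open import Level using (Level)
open import Data.List.Base using (List; []; _∷_; [_]; _++_)
open import Data.List.Membership.Propositional using () renaming (_∉_ to _∉ˡ_)
open import Data.List.Membership.Propositional.Properties using (∈-++⁻)
open import Data.List.Relation.Binary.BagAndSetEquality
  using ([_]-Equality; set; ∷-cong; bag-=⇒; ↭⇒∼bag)
open import Data.List.Relation.Binary.Disjoint.Propositional using (Disjoint)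
open import Data.List.Relation.Binary.Permutation.Propositional using (↭-sym)
open import Data.List.Relation.Binary.Permutation.Propositional.Properties using (shift)
open import Data.List.Relation.Binary.Subset.Propositional using (_⊆_)
open import Data.List.Relation.Binary.Subset.Propositional.Properties
  using (xs⊆xs++ys; xs⊆ys++xs; ∈-∷⁺ʳ)
open import Data.List.Relation.Unary.Any using (here; there)
open import Data.Product.Base using (∃₂; _×_; _,_)
open import Data.Sum.Base using (inj₁; inj₂; [_,_]′)
open import Function.Base using (id; _∘_)
open import Function.Bundles using (mk⇔)
open import Relation.Binary.Bundles using (Setoid)
open import Relation.Binary.PropositionalEquality using (_≢_; refl)
open import Relation.Nullary using (¬_; yes; no; contradiction; ¬¬-excluded-middle)

open Complex

private
  variable
    e p : Level
    E : Set e

≢[]⇒∈₀ : (K : Complex E p) (t : List E) → (t ≢ [] → t ∈ K) → t ∈₀ K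
≢[]⇒∈₀ K []      _   = inj₂ refl
≢[]⇒∈₀ K (_ ∷ _) t∈K = inj₁ (t∈K λ ())

∈₀⇒∈ : (K : Complex E p) {t : List E} → t ∈₀ K → t ≢ [] → t ∈ K
∈₀⇒∈ K (inj₁ t∈K)  _    = t∈K
∈₀⇒∈ K (inj₂ t≡[]) t≢[] = contradiction t≡[] t≢[]

++-⊆ : (s : List E) {t u : List E} → s ⊆ u → t ⊆ u → s ++ t ⊆ u
++-⊆ s s⊆u t⊆u = [ s⊆u , t⊆u ]′ ∘ ∈-++⁻ s

-- Without decidable equality on E, the lists t ∖ s and t ∩ s exist only up to
-- double negation.
¬¬-separate : (s t : List E) →
              ¬ ¬ (∃₂ λ a b → t ≈ a ++ b × Disjoint s a × b ⊆ s)
¬¬-separate s []      ¬sep = ¬sep ([] , [] , mk⇔ id id , (λ ()) , λ ())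
¬¬-separate {E = E} s (y ∷ t) ¬sep = ¬¬-separate s t
  λ (a , b , t≈ab , s#a , b⊆s) → ¬¬-excluded-middle λ where
    (yes y∈s) → ¬sep
      ( a , y ∷ b
      -- Here `y` joins `b`, which stands behind `a`, so it has to be moved past `a`.
      , S.trans (∷-cong refl t≈ab) (bag-=⇒ (↭⇒∼bag (↭-sym (shift y a b))))
      , s#a , ∈-∷⁺ʳ y∈s b⊆s)
    (no y∉s) → ¬sep
      ( y ∷ a , b , ∷-cong refl t≈ab
      , (λ { (v∈s , here refl) → y∉s v∈s ; (v∈s , there v∈a) → s#a (v∈s , v∈a) })
      , b⊆s)
  where module S = Setoid ([ set ]-Equality E)

⊆-++-∌ : {x : E} (a : List E) {c t : List E} →
         c ⊆ [ x ] → x ∉ˡ t → t ⊆ a ++ c → t ⊆ a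
⊆-++-∌ a c⊆x x∉t t⊆ac v∈t with ∈-++⁻ a (t⊆ac v∈t)
... | inj₁ v∈a = v∈a
... | inj₂ v∈c with here refl ← c⊆x v∈c = contradiction v∈t x∉t

∈₀-point⇒⊆ : {x : E} {c : List E} → c ∈₀ point x → c ⊆ [ x ]
∈₀-point⇒⊆ (inj₁ c≈x)  = ≈⇒⊆ c≈x
∈₀-point⇒⊆ (inj₂ refl) = λ ()

-- The face `u` is the union of some `a` and `c` with `c ⊆ [ x ]`. Since `t` avoids `x`, it lies in
-- `a`; since `t` is nonempty, `a` is a face of `A` and not the empty list.
⋆-point-∌ : (A : Complex E p) {x : E} {t u : List E} →
            t ≢ [] → x ∉ˡ t → t ⊆ u → u ∈ A ⋆ point x → t ∈ A
⋆-point-∌ A t≢[] x∉t t⊆u (_ , a , c , a∈A , c∈x , u≈ac) =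
  down-closed A (∈₀⇒∈ A a∈A (⊆-nonempty t⊆a t≢[])) t⊆a t≢[]
  where t⊆a = ⊆-++-∌ a (∈₀-point⇒⊆ c∈x) x∉t (≈⇒⊆ u≈ac ∘ t⊆u)

-- Split `t` into `a` outside `s` and `b` inside `s`. If `s ⊆ w`, then `s ++ a ⊆ w` is a face, so
-- `a` is empty or in the link. The part `b` is proper in `s`, as otherwise `s ⊆ t`.
∉Lk⋆∂⇒⊈ : (K : Complex E p) (s t : List E) → t ∈ K ∖St s → t ∉ Lk K s ⋆ ∂ s →
          {w : List E} → t ⊆ w → w ∈ K → ¬ (s ⊆ w)
-- The goal is now falsity, so a splitting known only up to double negation may be used.
∉Lk⋆∂⇒⊈ K s t (t∈K , s⊈t) t∉ {w} t⊆w w∈K s⊆w = ¬¬-separate s t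
  λ (a , b , t≈ab , s#a , b⊆s) →
    let a⊆w : a ⊆ w
        a⊆w = t⊆w ∘ ≈⇒⊇ t≈ab ∘ xs⊆xs++ys a b
        b⊆t : b ⊆ t
        b⊆t = ≈⇒⊇ t≈ab ∘ xs⊆ys++xs b a
    in t∉
      ( nonempty K t∈K , a , b
      , ≢[]⇒∈₀ (Lk K s) a (λ a≢[] →
            down-closed K w∈K a⊆w a≢[]
          , down-closed K w∈K (++-⊆ s s⊆w a⊆w) (⊆-nonempty (xs⊆ys++xs a s) a≢[])
          , s#a)
      , ≢[]⇒∈₀ (∂ s) b (λ b≢[] → b⊆s , b≢[] , λ b≈s → s⊈t (b⊆t ∘ ≈⇒⊇ b≈s))
      , t≈ab)

theorem3p7 : {e p : Level} {E : Set e} (K : Complex E p) (s : List E) → s ∈ K →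
    (x : E) → ¬ (V K x) →
    (t : List E) → t ∈ K ∖St s → t ∉ Lk K s ⋆ ∂ s →
    Lk (σ K s x) t ≗ Lk K t
theorem3p7 {E = E} K s s∈K x x∉V t t∈K∖St@(t∈K , _) t∉ = to , from
  where
  x∉t : x ∉ˡ t
  x∉t x∈t = x∉V (down-closed K t∈K (λ { (here refl) → x∈t }) λ ())

  to : {u : List E} → u ∈ Lk (σ K s x) t → u ∈ Lk K t
  to {u} (u∈σ , inj₁ (tu∈K , _) , t#u) =
    -- Whichever part of the subdivision `u` comes from, it is a face of `K` as a nonempty subset of
    -- `t ++ u`.
    down-closed K tu∈K (xs⊆ys++xs u t) (nonempty (σ K s x) u∈σ) , tu∈K , t#u
  to {u} (_ , inj₂ tu∈⋆ , _) = contradiction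
    (⋆-point-∌ (Lk K s ⋆ ∂ s) (nonempty K t∈K) x∉t (xs⊆xs++ys t u) tu∈⋆) t∉

  from : {u : List E} → u ∈ Lk K t → u ∈ Lk (σ K s x) t
  from {u} (u∈K , tu∈K , t#u) =
    -- Both `u` and `t ++ u` land in `K ∖St s`: as `u ⊆ t ++ u`, the single fact `s⊈tu` serves for
    -- both.
    inj₁ (u∈K , λ s⊆u → s⊈tu (xs⊆ys++xs u t ∘ s⊆u)) , inj₁ (tu∈K , s⊈tu) , t#u
    where s⊈tu = ∉Lk⋆∂⇒⊈ K s t t∈K∖St t∉ (xs⊆xs++ys t u) tu∈K
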